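{- Let $K$ be a $k$-dimensional USO and $h\in[k]$ some dimension. Let $P$ be some union of $h$-phases of $K$. Let $U\subset\{0,1\}^k$ be the set of vertices in the upper $h$-facet that are incident to an edge of $P$, and let $L=\{v\oplus h: v\in U\}$ be the set of their neighbors in the lower $h$-facet. Let $K_U$ and $K_L$ be the (oriented) subgraphs induced by $U$ and by $L$, respectively. Then swapping these two subgraphs yields an orientation $K'$ of $Q_k$, and $K'$ is a USO. Here swapping means that $K'$ is the function given by $$K'(v)=\begin{cases}K(v\oplus h) & \text{if } v\in U\cup L,\\ K(v)&\text{otherwise.}\end{cases}$$
   Context: $[k]=\{1,\ldots,k\}$. $Q_k$ is the $k$-dimensional hypercube graph with vertex set $\{0,1\}^k$; $v\oplus i$ denotes the neighbor of $v$ differing from $v$ exactly in coordinate $i$, and $\{v,v\oplus i\}$ is called an $i$-edge. The upper (lower) $h$-facet is the subgraph induced by the vertices $v$ with $v_h=1$ ($v_h=0$). An orientation $O$ of $Q_k$ directs every edge; it is identified with the function $O:\{0,1\}^k\to\{0,1\}^k$ where $O(v)_i=1$ if the edge $\{v,v\oplus i\}$ is directed upwards (from its endpoint in the lower $i$-facet to its endpoint in the upper $i$-facet) and $O(v)_i=0$ if it is directed downwards. Thus a function $O:\{0,1\}^k\to\{0,1\}^k$ is an orientation if and only if $O(v)_i=O(v\oplus i)_i$ for all $v$ and $i$. A face is the subgraph induced by all vertices that agree with a fixed string $f\in\{0,1,*\}^k$ on the non-$*$ positions. $O$ is a Unique Sink Orientation (USO) if every face contains exactly one vertex with no outgoing edges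 inside that face. Phases. Flipping a set of edges means reversing their directions. The $i$-phases of a USO $O$ are the minimal equivalence classes of the set of $i$-edges such that flipping any collection of these classes preserves the USO property; equivalently (by a known result of Schurr) they are the blocks of the unique partition of the set of (undirected) $i$-edges such that, for every set $P$ of $i$-edges, flipping $P$ in $O$ gives a USO if and only if $P$ is a union of blocks. -}

module Defs where

open import Data.Bool using (Bool; true; false; not; if_then_else_; _≟_)
open import Data.Bool.Properties using (not-involutive)
open import Data.Fin using (Fin)
open import Data.Maybe using (Maybe; just)
open import Data.Nat using (ℕ)
open import Data.Product using (∃!; ∃-syntax; _×_; _,_)
open import Data.Sum using (_⊎_)
open import Data.Vec using (Vec; lookup; updateAt; _[_]≔_)
open import Data.Vec.Properties using (updateAt-updateAt; updateAt-id-local; lookup∘updateAt)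
open import Function using (_⇔_)
open import Level using (0ℓ)
open import Relation.Binary using (Rel; IsDecEquivalence; _⇒_)
open import Relation.Binary.PropositionalEquality using (_≡_; refl; sym; trans; subst)
open import Relation.Nullary using (¬_; does; _×-dec_; _⊎-dec_)
open import Relation.Nullary.Decidable using (map′)
open import Relation.Unary using (Pred; Decidable; _∈_; _∪_)

Vertex : ℕ → Set
Vertex k = Vec Bool k

infixl 6 _⊕_

_⊕_ : {k : ℕ} → Vertex k → Fin k → Vertex k
v ⊕ i = updateAt v i not

⊕-involutive : {k : ℕ} (v : Vertex k) (i : Fin k) → v ⊕ i ⊕ i ≡ v
⊕-involutive v i =
  trans (updateAt-updateAt i v)
        (updateAt-id-local i v (not-involutive (lookup v i)))

-- An i-edge is represented by its endpoint in the lower i-facet.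
record Edge {k : ℕ} (i : Fin k) : Set where
  constructor mkEdge
  field
    lower    : Vertex k
    .isLower : lookup lower i ≡ false

-- The edge {v , v ⊕ i}.
edge : {k : ℕ} (i : Fin k) → Vertex k → Edge i
edge i v = mkEdge (v [ i ]≔ false) (lookup∘updateAt i v)

-- Sets of edges are Boolean-valued, so that flipping one is a function.
EdgeSet : {k : ℕ} → Fin k → Set
EdgeSet i = Edge i → Bool

infix 4 _∈ₑ_

_∈ₑ_ : {k : ℕ} {i : Fin k} → Edge i → EdgeSet i → Set
e ∈ₑ P = P e ≡ true

-- lookup (O v) i is true when {v , v ⊕ i} is directed from its endpoint with
-- i-th coordinate false to the one with i-th coordinate true.
IsOrientation : {k : ℕ} → (Vertex k → Vertex k) → Set
IsOrientation O = ∀ v i → lookup (O v) i ≡ lookup (O (v ⊕ i)) i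

Outgoing : {k : ℕ} → (Vertex k → Vertex k) → Vertex k → Fin k → Set
Outgoing O v i =
    (lookup v i ≡ false × lookup (O v) i ≡ true)
  ⊎ (lookup v i ≡ true × lookup (O v) i ≡ false)

-- Strings over {0,1,*}, with nothing in the role of *.
Face : ℕ → Set
Face k = Vec (Maybe Bool) k

⟦_⟧ : {k : ℕ} → Face k → Pred (Vertex k) 0ℓ
⟦ f ⟧ v = ∀ i b → lookup f i ≡ just b → lookup v i ≡ b

IsSinkOf : {k : ℕ} → (Vertex k → Vertex k) → Face k → Pred (Vertex k) 0ℓ
IsSinkOf O f v = v ∈ ⟦ f ⟧ × (∀ i → v ⊕ i ∈ ⟦ f ⟧ → ¬ Outgoing O v i)

record IsUSO {k : ℕ} (O : Vertex k → Vertex k) : Set where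
  field
    isOrientation : IsOrientation O
    uniqueSink    : ∀ f → ∃! _≡_ (IsSinkOf O f)

flip : {k : ℕ} {i : Fin k} → EdgeSet i → (Vertex k → Vertex k) → Vertex k → Vertex k
flip {i = i} P O v = if P (edge i v) then updateAt (O v) i not else O v

-- P is the union of the classes of the elements of S.
IsUnionOfClasses : {k : ℕ} {i : Fin k} → Rel (Edge i) 0ℓ → EdgeSet i → Set
IsUnionOfClasses {i = i} _~_ P =
  ∃[ S ] (∀ e → e ∈ₑ P ⇔ (∃[ s ] (_∈ₑ_ {i = i} s S × s ~ e)))

FlipsPreserveUSO : {k : ℕ} {i : Fin k} → (Vertex k → Vertex k) → Rel (Edge i) 0ℓ → Set
FlipsPreserveUSO O _~_ = ∀ P → IsUnionOfClasses _~_ P → IsUSO (flip P O)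

-- The classes of _~_ are the i-phases of O. Both _~_ and the relations it is
-- compared with are decidable: minimality among arbitrary Set-valued relations
-- could not be established constructively.
record IsPhaseRelation {k : ℕ} (O : Vertex k → Vertex k) (i : Fin k)
                       (_~_ : Rel (Edge i) 0ℓ) : Set₁ where
  field
    isDecEquivalence : IsDecEquivalence _~_
    flipsPreserveUSO : FlipsPreserveUSO O _~_
    minimal          : (_≈_ : Rel (Edge i) 0ℓ) → IsDecEquivalence _≈_ →
                       FlipsPreserveUSO O _≈_ → _≈_ ⇒ _~_ → _~_ ⇒ _≈_

module _ {k : ℕ} {h : Fin k} (P : EdgeSet h) where

  Upper : Pred (Vertex k) 0ℓ
  Upper v = lookup v h ≡ true × edge h v ∈ₑ P

  Lower : Pred (Vertex k) 0ℓ
  Lower w = ∃[ v ] (v ∈ Upper × w ≡ v ⊕ h)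

  upper? : Decidable Upper
  upper? v = (lookup v h ≟ true) ×-dec (P (edge h v) ≟ true)

  lower? : Decidable Lower
  lower? w = map′ to from (upper? (w ⊕ h))
    where
    to : w ⊕ h ∈ Upper → w ∈ Lower
    to p = w ⊕ h , p , sym (⊕-involutive w h)

    from : w ∈ Lower → w ⊕ h ∈ Upper
    from (v , p , refl) = subst Upper (sym (⊕-involutive v h)) p

  upper∪lower? : Decidable (Upper ∪ Lower)
  upper∪lower? v = upper? v ⊎-dec lower? v

  swap : (Vertex k → Vertex k) → Vertex k → Vertex k
  swap K v = if does (upper∪lower? v) then K (v ⊕ h) else K v

{-# OPTIONS --safe #-}

-- By Szabó and Welzl, an orientation O is a USO iff any two distinct vertices
-- v, w are separated: some i has v_i ≠ w_i and O(v)_i = O(w)_i. Both K and the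
-- USO obtained from K by flipping P separate a vertex u incident to P from a
-- vertex w not incident to P; since flipping P changes whether K(u)_h = K(w)_h
-- and nothing else, K separates u and w in a coordinate other than h. Applied
-- to u = v ⊕ h, this separates v from w in the swapped orientation, and if
-- w = v ⊕ i it says that the swapped orientation is consistent on the edge
-- between v and w.

module Submission where

open import Defs
open import Data.Bool using (Bool; true; false; not; _xor_; _≟_)
open import Data.Bool.Properties using (¬-not; not-¬)
open import Data.Fin using (Fin; zero; suc)
import Data.Fin.Properties as Fin
open import Data.Maybe using (Maybe; just; nothing)
open import Data.Nat using (ℕ)
open import Data.Product using (∃!; ∃-syntax; _×_; _,_)
open import Data.Sum using (inj₁; inj₂)
open import Data.Vec using (_∷_; []; lookup; map; replicate; zipWith; _[_]≔_)
open import Data.Vec.Properties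
  using (≡-dec; lookup-map; lookup-replicate; lookup-zipWith; lookup∘updateAt;
         lookup∘updateAt′; updateAt-updateAt; updateAt-commutes)
open import Function using (_∘_; case_of_)
open import Level using (0ℓ)
open import Relation.Binary using (Rel)
open import Relation.Binary.PropositionalEquality
  using (_≡_; _≢_; refl; sym; trans; cong; subst)
open import Relation.Nullary using (Dec; yes; no; ¬_; ¬?; _×-dec_; contradiction)
open import Relation.Nullary.Decidable using (dec-true; dec-false)
open import Relation.Unary using (Pred; _∈_; _∪_)

private
  variable
    k : ℕ
    O : Vertex k → Vertex k
    f : Face k
    m m′ u v w : Vertex k
    h i j : Fin k
    b : Bool

-- Vertices and faces

lookup-⊕-cong : (h i : Fin k) → lookup v i ≡ lookup w i →
                lookup (v ⊕ h) i ≡ lookup (w ⊕ h) i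
lookup-⊕-cong {v = v} {w} h i eq with i Fin.≟ h
... | yes refl = trans (lookup∘updateAt i v) (trans (cong not eq) (sym (lookup∘updateAt i w)))
... | no  i≢h  = trans (lookup∘updateAt′ i h i≢h v) (trans eq (sym (lookup∘updateAt′ i h i≢h w)))

lookup-⊕⁻ : (v w : Vertex k) (h i : Fin k) →
            lookup (v ⊕ h) i ≢ lookup (w ⊕ h) i → lookup v i ≢ lookup w i
lookup-⊕⁻ v w h i ≢ eq = ≢ (lookup-⊕-cong {v = v} {w} h i eq)

-- The cube is connected: coordinates are changed one at a time until `w` is reached.
-- `uso⇒uniqueOutmap` applies this to prescribed outmaps rather than to positions in the cube.
⊕-induction : (Q : Pred (Vertex k) 0ℓ) → (∀ v i → Q v → Q (v ⊕ i)) →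
              ∀ v w → Q v → Q w
⊕-induction Q step []      []      q = q
⊕-induction Q step (x ∷ v) (y ∷ w) q
  with q′ ← ⊕-induction (Q ∘ (x ∷_)) (λ u i → step (x ∷ u) (suc i)) v w q
  with x | y
... | false | false = q′
... | true  | true  = q′
... | false | true  = step _ zero q′
... | true  | false = step _ zero q′

-- Every face is built from single vertices, here `map just v`, by joining two opposite facets along
-- a free coordinate.
face-induction : (Q : Pred (Face k) 0ℓ) → (∀ v → Q (map just v)) →
                 (∀ f i → lookup f i ≡ nothing →
                   (∀ b → Q (f [ i ]≔ just b)) → Q f) →
                 ∀ f → Q f
face-induction Q base step []      = base []
face-induction Q base step (x ∷ f) = cons x
  where
  fixed : ∀ b → Q (just b ∷ f)
  fixed b = face-induction (Q ∘ (just b ∷_)) (base ∘ (b ∷_))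
                           (λ g i → step (just b ∷ g) (suc i)) f

  cons : ∀ x → Q (x ∷ f)
  cons (just b) = fixed b
  cons nothing  = step _ zero refl fixed

∈-⊕⇒free : v ⊕ i ∈ ⟦ f ⟧ → v ∈ ⟦ f ⟧ → lookup f i ≡ nothing
∈-⊕⇒free {v = v} {i = i} {f = f} v⊕i∈f v∈f with lookup f i in eq
... | nothing = refl
... | just b  = contradiction
  (trans (v∈f i b eq) (trans (sym (v⊕i∈f i b eq)) (lookup∘updateAt i v)))
  (not-¬ refl)

free⇒∈-⊕ : lookup f i ≡ nothing → v ∈ ⟦ f ⟧ → v ⊕ i ∈ ⟦ f ⟧
free⇒∈-⊕ {i = i} {v = v} free v∈f j b eq with j Fin.≟ i
... | yes refl = case trans (sym free) eq of λ ()
... | no  j≢i  = trans (lookup∘updateAt′ j i j≢i v) (v∈f j b eq)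

free-in-facet : (f : Face k) (i : Fin k) → lookup (f [ i ]≔ just b) j ≡ nothing →
                j ≢ i × lookup f j ≡ nothing
free-in-facet {j = j} f i free with j Fin.≟ i
... | yes refl = case trans (sym (lookup∘updateAt i f)) free of λ ()
... | no  j≢i  = j≢i , trans (sym (lookup∘updateAt′ j i j≢i f)) free

free-facet : (f : Face k) (i : Fin k) → j ≢ i → lookup f j ≡ nothing →
             lookup (f [ i ]≔ just b) j ≡ nothing
free-facet {j = j} f i j≢i free = trans (lookup∘updateAt′ j i j≢i f) free

facet⊆ : (f : Face k) (i : Fin k) → lookup f i ≡ nothing →
         v ∈ ⟦ f [ i ]≔ just b ⟧ → v ∈ ⟦ f ⟧
facet⊆ f i free v∈ j c eq with j Fin.≟ i
... | yes refl = case trans (sym free) eq of λ ()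
... | no  j≢i  = v∈ j c (trans (lookup∘updateAt′ j i j≢i f) eq)

∈-facet : (f : Face k) (i : Fin k) → v ∈ ⟦ f ⟧ → lookup v i ≡ b →
          v ∈ ⟦ f [ i ]≔ just b ⟧
∈-facet f i v∈f vi j c eq with j Fin.≟ i
... | no  j≢i  = v∈f j c (trans (sym (lookup∘updateAt′ j i j≢i f)) eq)
... | yes refl with refl ← trans (sym (lookup∘updateAt i f)) eq = vi

facet-lookup : (f : Face k) (i : Fin k) → v ∈ ⟦ f [ i ]≔ just b ⟧ → lookup v i ≡ b
facet-lookup f i v∈ = v∈ i _ (lookup∘updateAt i f)

spanFree : Bool → Bool → Maybe Bool
spanFree false false = just false
spanFree true  true  = just true
spanFree _     _     = nothing

-- The smallest face containing both vertices; its free coordinates are those in which they differ.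
span : Vertex k → Vertex k → Face k
span = zipWith spanFree

∈-spanˡ : (v w : Vertex k) → v ∈ ⟦ span v w ⟧
∈-spanˡ v w i b eq rewrite lookup-zipWith spanFree i v w with lookup v i | lookup w i | eq
... | false | false | refl = refl
... | true  | true  | refl = refl

∈-spanʳ : (v w : Vertex k) → w ∈ ⟦ span v w ⟧
∈-spanʳ v w i b eq rewrite lookup-zipWith spanFree i v w with lookup v i | lookup w i | eq
... | false | false | refl = refl
... | true  | true  | refl = refl

span-free : (v w : Vertex k) (i : Fin k) → lookup (span v w) i ≡ nothing →
            lookup v i ≢ lookup w i
span-free v w i eq rewrite lookup-zipWith spanFree i v w with lookup v i | lookup w i | eq
... | false | true  | _ = λ ()
... | true  | false | _ = λ ()

-- The Szabó–Welzl criterion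

Separated : (Vertex k → Vertex k) → Rel (Vertex k) 0ℓ
Separated O v w = ∃[ i ] (lookup v i ≢ lookup w i × lookup (O v) i ≡ lookup (O w) i)

-- Decidability allows `uso⇒separated` to argue by contradiction and still produce a coordinate.
separated? : (O : Vertex k → Vertex k) (v w : Vertex k) → Dec (Separated O v w)
separated? O v w =
  Fin.any? (λ i → ¬? (lookup v i ≟ lookup w i) ×-dec (lookup (O v) i ≟ lookup (O w) i))

-- `O` records up or down; the xor with `v` turns this into outgoing (`true`) or incoming (`false`)
-- at `v`.
outmap : (Vertex k → Vertex k) → Vertex k → Vertex k
outmap O v = zipWith _xor_ v (O v)

-- These are the sinks of f once all i-edges with m_i = 1 are reversed.
record HasOutmap {k : ℕ} (O : Vertex k → Vertex k) (m : Vertex k)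
                 (f : Face k) (v : Vertex k) : Set where
  constructor _,_
  field
    member   : v ∈ ⟦ f ⟧
    outmap-≡ : ∀ i → lookup f i ≡ nothing → lookup (outmap O v) i ≡ lookup m i

open HasOutmap

¬Outgoing⇒outmap : ¬ Outgoing O v i → lookup (outmap O v) i ≡ false
¬Outgoing⇒outmap {O = O} {v} {i} ¬out rewrite lookup-zipWith _xor_ i v (O v)
  with lookup v i | lookup (O v) i
... | false | false = refl
... | true  | true  = refl
... | false | true  = contradiction (inj₁ (refl , refl)) ¬out
... | true  | false = contradiction (inj₂ (refl , refl)) ¬out

outmap⇒¬Outgoing : lookup (outmap O v) i ≡ false → ¬ Outgoing O v i
outmap⇒¬Outgoing {O = O} {v} {i} eq out rewrite lookup-zipWith _xor_ i v (O v)
  with lookup v i | lookup (O v) i | out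
... | false | true  | _ = case eq of λ ()
... | true  | false | _ = case eq of λ ()
... | false | false | inj₁ (_ , ())
... | false | false | inj₂ (() , _)
... | true  | true  | inj₁ (() , _)
... | true  | true  | inj₂ (_ , ())

sink⇒outmap : IsSinkOf O f v → HasOutmap {k} O (replicate k false) f v
sink⇒outmap {O = O} {f = f} {v = v} (v∈f , sink) =
  v∈f , λ i free → trans
    (¬Outgoing⇒outmap {O = O} {v} {i} (sink i (free⇒∈-⊕ {f = f} {i} {v} free v∈f)))
    (sym (lookup-replicate i false))

outmap⇒sink : HasOutmap {k} O (replicate k false) f v → IsSinkOf O f v
outmap⇒sink {O = O} {f = f} {v = v} (v∈f , out) =
  v∈f , λ i v⊕i∈f → outmap⇒¬Outgoing {O = O} {v} {i}
    (trans (out i (∈-⊕⇒free {v = v} {i} {f} v⊕i∈f v∈f)) (lookup-replicate i false))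

-- On opposite sides of direction `i`, two `i`-edges point the same way exactly when one is outgoing
-- at its vertex and the other is incoming.
outmap-differs⇒agree : lookup v i ≢ lookup w i →
                       lookup (outmap O v) i ≢ lookup (outmap O w) i →
                       lookup (O v) i ≡ lookup (O w) i
outmap-differs⇒agree {v = v} {i} {w} {O} v≢w s≢
  rewrite lookup-zipWith _xor_ i v (O v) | lookup-zipWith _xor_ i w (O w)
  with lookup v i | lookup w i | lookup (O v) i | lookup (O w) i
... | false | false | _     | _     = contradiction refl v≢w
... | true  | true  | _     | _     = contradiction refl v≢w
... | _     | _     | false | false = refl
... | _     | _     | true  | true  = refl
... | false | true  | false | true  = contradiction refl s≢
... | false | true  | true  | false = contradiction refl s≢
... | true  | false | false | true  = contradiction refl s≢
... | true  | false | true  | false = contradiction refl s≢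

agree⇒outmap-differs : lookup v i ≢ lookup w i → lookup (O v) i ≡ lookup (O w) i →
                       lookup (outmap O v) i ≢ lookup (outmap O w) i
agree⇒outmap-differs {v = v} {i} {w} {O} v≢w O≡ s≡
  rewrite lookup-zipWith _xor_ i v (O v) | lookup-zipWith _xor_ i w (O w) | O≡
  with lookup v i | lookup w i | lookup (O w) i
... | false | false | _ = v≢w refl
... | true  | true  | _ = v≢w refl
... | false | true  | false = case s≡ of λ ()
... | false | true  | true  = case s≡ of λ ()
... | true  | false | false = case s≡ of λ ()
... | true  | false | true  = case s≡ of λ ()

-- Changing the prescribed outmap in one direction

AgreeOff : Fin k → Rel (Vertex k) 0ℓ
AgreeOff i m m′ = ∀ j → j ≢ i → lookup m j ≡ lookup m′ j

⊕-agreeOff : (m : Vertex k) (i : Fin k) → AgreeOff i m (m ⊕ i)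
⊕-agreeOff m i j j≢i = sym (lookup∘updateAt′ j i j≢i m)

outmap-unused : AgreeOff i m m′ → lookup f i ≡ just b →
                HasOutmap O m f v → HasOutmap O m′ f v
outmap-unused agree fixed (v∈f , out) = v∈f , λ j free →
  trans (out j free) (agree j λ { refl → case trans (sym fixed) free of λ () })

-- In a facet that fixes `i`, entry `i` of the prescribed outmap is not consulted. Keeping `m′`
-- apart from `m` covers both a change at `i` and no change.
outmap-facet : (f : Face k) → AgreeOff i m m′ → HasOutmap O m f v → lookup v i ≡ b →
               HasOutmap O m′ (f [ i ]≔ just b) v
outmap-facet {i = i} {v = v} f agree (v∈f , out) vi = ∈-facet {v = v} f i v∈f vi , λ j free →
  let j≢i , free′ = free-in-facet f i free in trans (out j free′) (agree j j≢i)

outmap-extend : (f : Face k) → lookup f i ≡ nothing → AgreeOff i m m′ →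
                HasOutmap O m (f [ i ]≔ just b) v →
                lookup (outmap O v) i ≡ lookup m′ i → HasOutmap O m′ f v
outmap-extend {i = i} {m = m} {m′} {O} {b} {v} f free agree (v∈ , out) eq =
  facet⊆ {v = v} f i free v∈ , out′
  where
  out′ : ∀ j → lookup f j ≡ nothing → lookup (outmap O v) j ≡ lookup m′ j
  out′ j free′ with j Fin.≟ i
  ... | yes refl = eq
  ... | no  j≢i  = trans (out j (free-facet f i j≢i free′)) (agree j j≢i)

AgreeOff-refl : AgreeOff i m m
AgreeOff-refl j _ = refl

-- If i is free in f, the sinks of the two i-facets of f are the only candidates
-- for the sink of f; exactly one of them is the sink, and reversing all i-edges
-- makes it the other one.
outmap-shift : (∀ f → ∃! _≡_ (HasOutmap O m f)) → ∀ i f → ∃! _≡_ (HasOutmap O (m ⊕ i) f)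
outmap-shift {O = O} {m} unique i f with lookup f i in fi
... | just b =
  let x , hx , x-unique = unique f in
    x
  , outmap-unused (⊕-agreeOff m i) fi hx
  , λ hy → x-unique (outmap-unused (λ j j≢i → sym (⊕-agreeOff m i j j≢i)) fi hy)
... | nothing = exists
  where
  off : AgreeOff i (m ⊕ i) m
  off j j≢i = sym (⊕-agreeOff m i j j≢i)

  unique-≡ : ∀ g {x y} → HasOutmap O m g x → HasOutmap O m g y → x ≡ y
  unique-≡ g hx hy = let _ , _ , u = unique g in trans (sym (u hx)) (u hy)

  -- In a common `i`-facet, `x` and `z` would both realize `m` there and hence coincide, but their
  -- outmaps differ at `i`.
  clash : ∀ {x z} → HasOutmap O (m ⊕ i) f x → HasOutmap O m f z → lookup z i ≢ lookup x i
  clash {x} {z} hx hz zi≡xi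
    with refl ← unique-≡ (f [ i ]≔ just (lookup x i))
           (outmap-facet f off hx refl)
           (outmap-facet f (AgreeOff-refl {m = m}) hz zi≡xi)
    = not-¬ refl (trans (sym (outmap-≡ hz i fi)) (trans (outmap-≡ hx i fi) (lookup∘updateAt i m)))

  ≡-new : ∀ {x y} → HasOutmap O (m ⊕ i) f x → HasOutmap O (m ⊕ i) f y → x ≡ y
  ≡-new {x} {y} hx hy with lookup x i ≟ lookup y i
  ... | yes eq = unique-≡ (f [ i ]≔ just (lookup x i))
                   (outmap-facet f off hx refl)
                   (outmap-facet f off hy (sym eq))
  -- The vertex `z` realizing `m` on `f` would have to avoid both `i`-facets.
  ... | no  x≢y =
    let z , hz , _ = unique f in
    contradiction (trans (¬-not (clash hx hz)) (sym (¬-not (x≢y ∘ sym)))) (clash hy hz)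

  new : ∀ {x b} → HasOutmap O m (f [ i ]≔ just b) x → lookup (outmap O x) i ≢ lookup m i →
        ∃! _≡_ (HasOutmap O (m ⊕ i) f)
  new {x} hx ≢ = x , hx′ , ≡-new hx′
    where
    hx′ : HasOutmap O (m ⊕ i) f x
    hx′ = outmap-extend f fi (⊕-agreeOff m i) hx
          (trans (¬-not ≢) (sym (lookup∘updateAt i m)))

  exists : ∃! _≡_ (HasOutmap O (m ⊕ i) f)
  exists
    with x , hx , _ ← unique (f [ i ]≔ just false)
       | y , hy , _ ← unique (f [ i ]≔ just true)
    with lookup (outmap O x) i ≟ lookup m i | lookup (outmap O y) i ≟ lookup m i
  ... | no ≢   | _      = new hx ≢
  ... | yes _  | no ≢   = new hy ≢
  -- Both candidates would realize `m` on all of `f`, yet they lie in opposite `i`-facets.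
  ... | yes ex | yes ey
    with refl ← unique-≡ f (outmap-extend f fi (AgreeOff-refl {m = m}) hx ex)
                           (outmap-extend f fi (AgreeOff-refl {m = m}) hy ey)
    = case trans (sym (facet-lookup {v = x} f i (member hx)))
                 (facet-lookup {v = x} f i (member hy)) of λ ()

-- The all-false pattern describes sinks, and `outmap-shift` changes one entry at a time to reach
-- any `m`. Thus the outmap of a USO is a bijection on every face.
uso⇒uniqueOutmap : IsUSO O → ∀ m f → ∃! _≡_ (HasOutmap O m f)
uso⇒uniqueOutmap {k} {O} uso m =
  ⊕-induction (λ m → ∀ f → ∃! _≡_ (HasOutmap O m f))
              (λ m i u → outmap-shift {O = O} {m} u i)
              (replicate k false) m base
  where
  base : ∀ f → ∃! _≡_ (HasOutmap O (replicate k false) f)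
  base f = let v , sink , u = IsUSO.uniqueSink uso f in
    v , sink⇒outmap sink , λ hy → u (outmap⇒sink hy)

-- Vertices that are not separated have equal outmaps in all directions in which they differ. These
-- are the free directions of `span v w`, so uniqueness of the outmap in that face forces the
-- vertices to coincide.
uso⇒separated : IsUSO O → v ≢ w → Separated O v w
uso⇒separated {O = O} {v} {w} uso v≢w with separated? O v w
... | yes sep = sep
... | no ¬sep =
  let _ , _ , u = uso⇒uniqueOutmap uso (outmap O v) (span v w) in
  contradiction (trans (sym (u (∈-spanˡ v w , λ _ _ → refl))) (u (∈-spanʳ v w , same))) v≢w
  where
  same : ∀ i → lookup (span v w) i ≡ nothing → lookup (outmap O w) i ≡ lookup (outmap O v) i
  same i free with lookup (outmap O w) i ≟ lookup (outmap O v) i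
  ... | yes eq = eq
  ... | no  s≢ = contradiction
    ( i
    , span-free v w i free
    , outmap-differs⇒agree {v = v} {i} {w} {O} (span-free v w i free) (s≢ ∘ sym))
    ¬sep

-- If neither facet's sink is a sink of `f`, then both have an outgoing `i`-edge. Their outmaps then
-- agree in all free directions of `f`, which include all those in which they differ, so they are
-- not separated.
separated⇒sink : (∀ {v w} → v ≢ w → Separated O v w) →
                 ∀ f → ∃[ v ] HasOutmap {k} O (replicate k false) f v
separated⇒sink {k} {O} sep = face-induction _ base step
  where
  𝟎 = replicate k false

  base : ∀ v → ∃[ x ] HasOutmap O 𝟎 (map just v) x
  base v = v , (λ { i b eq → case trans (sym (lookup-map i just v)) eq of λ { refl → refl } })
             , λ i eq → case trans (sym (lookup-map i just v)) eq of λ ()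

  step : ∀ f i → lookup f i ≡ nothing → (∀ b → ∃[ x ] HasOutmap O 𝟎 (f [ i ]≔ just b) x) →
         ∃[ x ] HasOutmap O 𝟎 f x
  step f i fi facets
    with x , hx ← facets false | y , hy ← facets true
    with lookup (outmap O x) i ≟ lookup 𝟎 i | lookup (outmap O y) i ≟ lookup 𝟎 i
  ... | yes ex | _      = x , outmap-extend f fi (AgreeOff-refl {m = 𝟎}) hx ex
  ... | no _   | yes ey = y , outmap-extend f fi (AgreeOff-refl {m = 𝟎}) hy ey
  ... | no x≢  | no y≢  =
    let j , xj≢yj , eq = sep x≢y in
    contradiction (same j xj≢yj) (agree⇒outmap-differs {v = x} {j} {y} {O} xj≢yj eq)
    where
    x≢y : x ≢ y
    x≢y refl = case trans (sym (facet-lookup {v = x} f i (member hx)))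
                          (facet-lookup {v = x} f i (member hy)) of λ ()

    same : ∀ j → lookup x j ≢ lookup y j → lookup (outmap O x) j ≡ lookup (outmap O y) j
    same j xj≢yj with j Fin.≟ i
    ... | yes refl = trans (¬-not x≢) (sym (¬-not y≢))
    ... | no  j≢i with lookup f j in fj
    ...   | nothing = trans (outmap-≡ hx j (free-facet f i j≢i fj))
                            (sym (outmap-≡ hy j (free-facet f i j≢i fj)))
    ...   | just c  = contradiction
      (trans (facet⊆ {v = x} f i fi (member hx) j c fj)
             (sym (facet⊆ {v = y} f i fi (member hy) j c fj)))
      xj≢yj

separated⇒uso : IsOrientation O → (∀ {v w} → v ≢ w → Separated O v w) → IsUSO O
separated⇒uso {k} {O} orient sep = record { isOrientation = orient ; uniqueSink = uniqueSink }
  where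
  -- A coordinate separating two sinks of `f` must be free in `f`; there their outmaps differ,
  -- although both are false.
  sinks-≡ : ∀ f {x y} → HasOutmap O (replicate k false) f x →
            HasOutmap O (replicate k false) f y → x ≡ y
  sinks-≡ f {x} {y} (x∈f , hx) (y∈f , hy) with ≡-dec _≟_ x y
  ... | yes x≡y = x≡y
  ... | no  x≢y with i , xi≢yi , eq ← sep x≢y with lookup f i in fi
  ...   | just b  = contradiction (trans (x∈f i b fi) (sym (y∈f i b fi))) xi≢yi
  ...   | nothing = contradiction (trans (hx i fi) (sym (hy i fi)))
                                  (agree⇒outmap-differs {v = x} {i} {y} {O} xi≢yi eq)

  uniqueSink : ∀ f → ∃! _≡_ (IsSinkOf O f)
  uniqueSink f = let v , hv = separated⇒sink sep f in
      v
    , outmap⇒sink hv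
    , λ sink → sinks-≡ f hv (sink⇒outmap sink)

-- Swapping

-- The field `isLower` is irrelevant, so the lower endpoint determines the edge.
mkEdge-≡ : {e e′ : Edge h} → Edge.lower e ≡ Edge.lower e′ → e ≡ e′
mkEdge-≡ refl = refl

edge-⊕ : (h : Fin k) (v : Vertex k) → edge h (v ⊕ h) ≡ edge h v
edge-⊕ h v = mkEdge-≡ (updateAt-updateAt h v)

⊕-injective : (h : Fin k) → v ⊕ h ≡ w ⊕ h → v ≡ w
⊕-injective {v = v} {w} h eq =
  trans (sym (⊕-involutive v h)) (trans (cong (_⊕ h) eq) (⊕-involutive w h))

module _ {k : ℕ} {h : Fin k} (P : EdgeSet h) where

  -- Together with the converse below, this reduces the case distinction in `swap` to the Boolean
  -- `P (edge h v)`.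
  Upper∪Lower⇒∈ : v ∈ Upper P ∪ Lower P → edge h v ∈ₑ P
  Upper∪Lower⇒∈ (inj₁ (_ , e∈P))              = e∈P
  Upper∪Lower⇒∈ (inj₂ (u , (_ , e∈P) , refl)) = trans (cong P (edge-⊕ h u)) e∈P

  ∈⇒Upper∪Lower : edge h v ∈ₑ P → v ∈ Upper P ∪ Lower P
  ∈⇒Upper∪Lower {v} e∈P with lookup v h ≟ true
  ... | yes vh = inj₁ (vh , e∈P)
  ... | no  vh = inj₂
    (v ⊕ h
    , (trans (lookup∘updateAt h v) (sym (¬-not (vh ∘ sym))) , trans (cong P (edge-⊕ h v)) e∈P)
    , sym (⊕-involutive v h))

  swap-in : (K : Vertex k → Vertex k) → P (edge h v) ≡ true → swap P K v ≡ K (v ⊕ h)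
  swap-in {v} K eq rewrite dec-true (upper∪lower? P v) (∈⇒Upper∪Lower eq) = refl

  swap-out : (K : Vertex k → Vertex k) → P (edge h v) ≡ false → swap P K v ≡ K v
  swap-out {v} K eq
    rewrite dec-false (upper∪lower? P v)
                      (λ v∈ → case trans (sym eq) (Upper∪Lower⇒∈ v∈) of λ ()) = refl

  -- The index is the value of the swapped map, so matching on a view replaces that value by the
  -- applicable case.
  data SwapView (K : Vertex k → Vertex k) (v : Vertex k) : Vertex k → Set where
    inside  : P (edge h v) ≡ true  → SwapView K v (K (v ⊕ h))
    outside : P (edge h v) ≡ false → SwapView K v (K v)

  swapView : (K : Vertex k → Vertex k) (v : Vertex k) → SwapView K v (swap P K v)
  swapView K v = view _ refl
    where
    view : ∀ b → P (edge h v) ≡ b → SwapView K v (swap P K v)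
    view true  eq = subst (SwapView K v) (sym (swap-in K eq)) (inside eq)
    view false eq = subst (SwapView K v) (sym (swap-out K eq)) (outside eq)

  ∈∉⇒≢ : P (edge h u) ≡ true → P (edge h w) ≡ false → u ≢ w
  ∈∉⇒≢ u∈ w∉ refl = case trans (sym u∈) w∉ of λ ()

  flip-in : (O : Vertex k → Vertex k) → P (edge h v) ≡ true →
            lookup (flip P O v) h ≡ not (lookup (O v) h)
  flip-in {v} O eq rewrite eq = lookup∘updateAt h (O v)

  flip-out : (O : Vertex k → Vertex k) → P (edge h v) ≡ false → flip P O v ≡ O v
  flip-out {v} O eq rewrite eq = refl

  flip-other : (O : Vertex k → Vertex k) (v : Vertex k) → i ≢ h →
               lookup (flip P O v) i ≡ lookup (O v) i
  flip-other {i} O v i≢h with P (edge h v)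
  ... | true  = lookup∘updateAt′ i h i≢h (O v)
  ... | false = refl

  -- Separation and consistency after the swap

  module _ {K : Vertex k → Vertex k} (uso : IsUSO K) (flip-uso : IsUSO (flip P K)) where

    separated-off : P (edge h u) ≡ true → P (edge h w) ≡ false →
      ∃[ i ] (i ≢ h × lookup u i ≢ lookup w i × lookup (K u) i ≡ lookup (K w) i)
    separated-off {u} {w} u∈ w∉
      with i , ui≢wi , eq ← uso⇒separated uso (∈∉⇒≢ u∈ w∉)
         | j , uj≢wj , eq′ ← uso⇒separated flip-uso (∈∉⇒≢ u∈ w∉)
      with i Fin.≟ h | j Fin.≟ h
    ... | no i≢h   | _        = i , i≢h , ui≢wi , eq
    ... | yes _    | no j≢h   =
      j , j≢h , uj≢wj , trans (sym (flip-other K u j≢h)) (trans eq′ (flip-other K w j≢h))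
    ... | yes refl | yes refl =
      contradiction (trans eq (trans (cong (λ x → lookup x h) (sym (flip-out K w∉)))
                                     (trans (sym eq′) (flip-in K u∈))))
                    (not-¬ refl)

    -- `v ⊕ h` lies on the same `h`-edge as `v`. The two vertices agree off `h`, so `i ≢ h` lets the
    -- coordinate distinguish `v` itself from `w`.
    separated-off-⊕ : P (edge h v) ≡ true → P (edge h w) ≡ false →
      ∃[ i ] (i ≢ h × lookup v i ≢ lookup w i × lookup (K (v ⊕ h)) i ≡ lookup (K w) i)
    separated-off-⊕ {v} {w} v∈ w∉ with separated-off (trans (cong P (edge-⊕ h v)) v∈) w∉
    ... | i , i≢h , ≢ , eq =
      i , i≢h , subst (_≢ lookup w i) (lookup∘updateAt′ i h i≢h v) ≢ , eq

    swap-separated : v ≢ w → Separated (swap P K) v w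
    swap-separated {v} {w} v≢w with swap P K v | swapView K v | swap P K w | swapView K w
    -- Moving both vertices across `h` does not change the set of coordinates in which they differ.
    ... | _ | inside  _  | _ | inside  _  =
      let i , ≢ , eq = uso⇒separated uso (v≢w ∘ ⊕-injective h) in
      i , lookup-⊕⁻ v w h i ≢ , eq
    ... | _ | outside _  | _ | outside _  = uso⇒separated uso v≢w
    ... | _ | inside  v∈ | _ | outside w∉ =
      let i , _ , ≢ , eq = separated-off-⊕ v∈ w∉ in i , ≢ , eq
    ... | _ | outside v∉ | _ | inside  w∈ =
      let i , _ , ≢ , eq = separated-off-⊕ w∈ v∉ in i , ≢ ∘ sym , sym eq

    -- `v` and `v ⊕ i` differ only at `i`, so the separating coordinate can only be `i`.
    swap-crossing : (v : Vertex k) (i : Fin k) → P (edge h v) ≡ true →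
                    P (edge h (v ⊕ i)) ≡ false →
                    lookup (K (v ⊕ h)) i ≡ lookup (K (v ⊕ i)) i
    swap-crossing v i v∈ w∉ with j , _ , vj≢ , eq ← separated-off-⊕ v∈ w∉ with j Fin.≟ i
    ... | yes refl = eq
    ... | no  j≢i  = contradiction (sym (lookup∘updateAt′ j i j≢i v)) vj≢

    swap-orientation : IsOrientation (swap P K)
    swap-orientation v i
      with i Fin.≟ h | swap P K v | swapView K v | swap P K (v ⊕ i) | swapView K (v ⊕ i)
    ... | _        | _ | outside _  | _ | outside _  = IsUSO.isOrientation uso v i
    ... | yes refl | _ | inside  _  | _ | inside  _  = IsUSO.isOrientation uso (v ⊕ h) h
    -- The two endpoints of an `h`-edge share that edge, so membership in `P` cannot differ.
    ... | yes refl | _ | inside  v∈ | _ | outside w∉ =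
      case trans (sym v∈) (trans (sym (cong P (edge-⊕ h v))) w∉) of λ ()
    ... | yes refl | _ | outside v∉ | _ | inside  w∈ =
      case trans (sym w∈) (trans (cong P (edge-⊕ h v)) v∉) of λ ()
    -- The edge takes the direction of its parallel copy across `h`.
    ... | no i≢h   | _ | inside  _  | _ | inside  _  =
      trans (IsUSO.isOrientation uso (v ⊕ h) i)
            (cong (λ x → lookup (K x) i) (updateAt-commutes i h i≢h v))
    ... | no _     | _ | inside  v∈ | _ | outside w∉ = swap-crossing v i v∈ w∉
    -- The same crossing, viewed from the endpoint `v ⊕ i`.
    ... | no _     | _ | outside v∉ | _ | inside  w∈ =
      trans (cong (λ x → lookup (K x) i) (sym (⊕-involutive v i)))
            (sym (swap-crossing (v ⊕ i) i w∈ (trans (cong (P ∘ edge h) (⊕-involutive v i)) v∉)))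

corollary28 : (k : ℕ) (K : Vertex k → Vertex k) → IsUSO K →
    (h : Fin k) (_~_ : Rel (Edge h) 0ℓ) → IsPhaseRelation K h _~_ →
    (P : EdgeSet h) → IsUnionOfClasses _~_ P →
    IsOrientation (swap P K) × IsUSO (swap P K)
corollary28 k K uso h _~_ phases P P-union =
  orient , separated⇒uso orient (swap-separated P uso flip-uso)
  where
  flip-uso : IsUSO (flip P K)
  -- This supplies the second USO, whose separating coordinates `separated-off` compares with those
  -- of `K`.
  flip-uso = IsPhaseRelation.flipsPreserveUSO phases P P-union

  orient : IsOrientation (swap P K)
  orient = swap-orientation P uso flip-uso
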